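{- Let $r\ge 2$ and $n\ge 1$ be integers and let $0\le c_1\le c_2\le\cdots\le c_r$ be letter lengths. Let $m^*$ be the minimum number of non-terminals in any optimal tree (with $n$ terminals). Then any shallow tree (with $n$ terminals) having exactly $m^*$ non-terminals is optimal and proper.
   Context: The infinite $r$-ary tree is the infinite rooted tree in which every node has exactly $r$ ordered children; the edge from a node to its $i$th child has length $c_i$. A node means a node of this infinite tree; $\mathrm{depth}(u)$ is the sum of the edge lengths on the path from the root to $u$. A tree is a subtree $T$ of the infinite $r$-ary tree containing the root, in which $n$ of the leaves are designated as terminals; all the other nodes of $T$ are called non-terminals (a non-terminal is allowed to have no children in $T$). The cost $c(T)$ is the sum of the depths of the terminals of $T$. A tree is optimal if it has minimum cost among all trees with $n$ terminals. A tree is proper if every non-terminal has at least two children in the tree. A tree $T$ is shallow if (i) for any non-terminal $u\in T$ and any node $w$ (not necessarily in $T$) that is not a non-terminal of $T$, $\mathrm{depth}(u)\le\mathrm{depth}(w)$; and (ii) for any terminal $u\in T$ and any node $w$ that is not in $T$ but is a child of a non-terminal of $T$, $\mathrm{depth}(u)\le\mathrm{depth}(w)$. -}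

module Defs where

open import Level using (Level; _⊔_) renaming (suc to lsuc)
open import Algebra.Core using (Op₁; Op₂)
open import Algebra.Structures using (IsAbelianGroup)
open import Data.Fin using (Fin)
open import Data.List using (List; []; _∷_; foldr; length; map)
open import Data.List.Membership.Propositional using (_∈_; _∉_)
open import Data.List.Relation.Binary.Disjoint.Propositional using (Disjoint)
open import Data.List.Relation.Unary.Unique.Propositional using (Unique)
open import Data.Nat using (ℕ) renaming (_≤_ to _≤ℕ_)
open import Data.Product using (_×_; ∃-syntax)
open import Data.Sum using (_⊎_)
open import Relation.Binary.Core using (Rel; _Preserves₂_⟶_⟶_)
open import Relation.Binary.Structures using (IsPartialOrder)
open import Relation.Binary.PropositionalEquality using (_≡_; _≢_)
open import Relation.Nullary using (¬_)

-- The numbers in which lengths are measured: ℤ, ℚ and ℝ are instances.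
-- Totality of ≤ is not demanded, so that the constructive reals, whose order
-- is not provably total, are instances too.
record OrderedAbelianGroup (a ℓ₁ ℓ₂ : Level) : Set (lsuc (a ⊔ ℓ₁ ⊔ ℓ₂)) where
  infix  8 -_
  infixl 6 _+_
  infix  4 _≈_ _≤_
  field
    Carrier        : Set a
    _≈_            : Rel Carrier ℓ₁
    _≤_            : Rel Carrier ℓ₂
    _+_            : Op₂ Carrier
    0#             : Carrier
    -_             : Op₁ Carrier
    isAbelianGroup : IsAbelianGroup _≈_ _+_ 0# -_
    isPartialOrder : IsPartialOrder _≈_ _≤_
    +-mono-≤       : _+_ Preserves₂ _≤_ ⟶ _≤_ ⟶ _≤_

-- A node of the infinite r-ary tree is the list of the edge labels on its path
-- to the root, last edge first, so [] is the root and i ∷ u is the i-th child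
-- of u.
Node : ℕ → Set
Node r = List (Fin r)

-- A finite subtree of the infinite r-ary tree containing the root, with n of
-- its leaves designated as terminals. The lists are duplicate-free and stand
-- for finite sets; the node set is their disjoint union.
record Tree (r n : ℕ) : Set where
  field
    nonTerminals        : List (Node r)
    terminals           : List (Node r)
    nonTerminals-unique : Unique nonTerminals
    terminals-unique    : Unique terminals
    disjoint            : Disjoint nonTerminals terminals

  _∈T : Node r → Set
  u ∈T = u ∈ nonTerminals ⊎ u ∈ terminals

  field
    root-∈         : [] ∈T
    parent-∈       : ∀ {u i} → (i ∷ u) ∈T → u ∈T
    terminals-leaf : ∀ {u i} → u ∈ terminals → ¬ ((i ∷ u) ∈T)
    n-terminals    : length terminals ≡ n

  #nonTerminals : ℕ
  #nonTerminals = length nonTerminals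

Proper : ∀ {r n} → Tree r n → Set
Proper T = ∀ {u} → u ∈ nonTerminals → ∃[ i ] ∃[ j ] (i ≢ j × (i ∷ u) ∈T × (j ∷ u) ∈T)
  where open Tree T

module Lengths {a ℓ₁ ℓ₂ : Level} (G : OrderedAbelianGroup a ℓ₁ ℓ₂) {r : ℕ}
               (c : Fin r → OrderedAbelianGroup.Carrier G) where

  open OrderedAbelianGroup G

  depth : Node r → Carrier
  depth u = foldr _+_ 0# (map c u)

  cost : ∀ {n} → Tree r n → Carrier
  cost T = foldr _+_ 0# (map depth (Tree.terminals T))

  Optimal : ∀ {n} → Tree r n → Set ℓ₂
  Optimal {n} T = ∀ (T′ : Tree r n) → cost T ≤ cost T′

  record Shallow {n : ℕ} (T : Tree r n) : Set ℓ₂ where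
    open Tree T
    field
      nonTerminals-shallow : ∀ {u w} → u ∈ nonTerminals → w ∉ nonTerminals → depth u ≤ depth w
      terminals-shallow    : ∀ {u v i} → u ∈ terminals → v ∈ nonTerminals → ¬ ((i ∷ v) ∈T) →
                             depth u ≤ depth (i ∷ v)

  record IsMinNonTerminals (n m : ℕ) : Set ℓ₂ where
    field
      attained : ∃[ T ] (Optimal {n} T × Tree.#nonTerminals T ≡ m)
      minimal  : ∀ (T : Tree r n) → Optimal T → m ≤ℕ Tree.#nonTerminals T

{-# OPTIONS --safe #-}
module Submission where

-- A non-terminal with at most one child can be spliced out without raising the
-- cost, so an optimal tree with m* non-terminals is proper.  Let S be the set of
-- non-terminals of the shallow tree and N that of an optimal tree with m*
-- non-terminals.  If N ≠ S, take a deepest u in N ∖ S and a topmost w in S ∖ N: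
-- then w is no deeper than u, all children of u are terminals, and there is at
-- least one.  Moving them from u to w (with u becoming a terminal if w was one)
-- does not raise the cost and brings N closer to S.  Once N = S, shallowness
-- lets the terminals be exchanged one by one for those of the shallow tree.

open import Defs
open import Algebra.Bundles using (CommutativeMonoid)
open import Algebra.Structures using (IsAbelianGroup)
open import Data.Fin using (Fin) renaming (_≤_ to _≤ᶠ_)
import Data.Fin as Fin
import Data.Fin.Properties as Finₚ
open import Data.List using (List; []; _∷_; _++_; foldr; length; map; filter)
open import Data.List.Membership.Propositional using (_∈_; _∉_; find)
open import Data.List.Membership.Propositional.Properties using (∈-∃++; ∈-map⁺; ∈-map⁻; ∈-filter⁺; ∈-filter⁻)
import Data.List.Membership.DecPropositional as DecMembership
open import Data.List.Properties using (≡-dec; length-map; ++-cancelʳ; ++-identityʳ; ++-identityˡ-unique; ∷-injectiveˡ; ∷-injectiveʳ; filter-accept; filter-reject)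
open import Data.List.Relation.Binary.Disjoint.Propositional using (Disjoint)
open import Data.List.Relation.Binary.Permutation.Propositional using (_↭_; ↭-sym; ↭⇒↭ₛ)
import Data.List.Relation.Binary.Permutation.Propositional as Perm
open import Data.List.Relation.Binary.Permutation.Propositional.Properties using (∈-resp-↭; ↭-length; shift; filter-↭)
import Data.List.Relation.Binary.Permutation.Setoid.Properties as PermSetoid
open import Data.List.Relation.Binary.Subset.Propositional using (_⊆_)
open import Data.List.Relation.Unary.All as All using (All; []; _∷_)
open import Data.List.Relation.Unary.All.Properties using (¬Any⇒All¬; All¬⇒¬Any)
import Data.List.Relation.Unary.All.Properties as Allₚ
open import Data.List.Relation.Unary.AllPairs using ([]; _∷_)
open import Data.List.Relation.Unary.Any using (here; there)
open import Data.List.Relation.Unary.Unique.Propositional using (Unique)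
open import Data.Nat using (ℕ; suc; s≤s) renaming (_≤_ to _≤ℕ_)
import Data.Nat.Properties as ℕₚ
open import Data.Product using (_×_; _,_; proj₁; proj₂; ∃-syntax)
open import Data.Sum using (_⊎_; inj₁; inj₂; [_,_]′) renaming (map to ⊎-map)
open import Function using (_∘_; id)
open import Level using (Level)
open import Relation.Binary.Bundles using (Poset)
open import Relation.Binary.Definitions using (DecidableEquality)
open import Relation.Binary.Structures using (IsPartialOrder)
open import Relation.Binary.PropositionalEquality using (_≡_; _≢_; refl; sym; trans; cong; subst; subst₂; setoid)
open import Relation.Nullary using (¬_; Dec; yes; no; contradiction)
open import Relation.Nullary.Decidable using (_⊎-dec_; _×-dec_; ¬?; decidable-stable)

-- Duplicate-free lists as finite sets.

private
  variable
    ℓ : Level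
    A B : Set ℓ

∈⇒↭∷ : {x : A} {xs : List A} → x ∈ xs → ∃[ ys ] xs ↭ x ∷ ys
∈⇒↭∷ x∈xs with ys , zs , refl ← ∈-∃++ x∈xs = ys ++ zs , shift _ ys zs

Unique-resp-↭ : {xs ys : List A} → xs ↭ ys → Unique xs → Unique ys
Unique-resp-↭ xs↭ys = PermSetoid.Unique-resp-↭ (setoid _) (↭⇒↭ₛ xs↭ys)

Unique-head : {x : A} {xs : List A} → Unique (x ∷ xs) → x ∉ xs
Unique-head (x≢ ∷ _) = All¬⇒¬Any x≢

Unique-∷ : {x : A} {xs : List A} → x ∉ xs → Unique xs → Unique (x ∷ xs)
Unique-∷ x∉xs xs! = ¬Any⇒All¬ _ x∉xs ∷ xs!

Unique-tail : {x : A} {xs : List A} → Unique (x ∷ xs) → Unique xs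
Unique-tail (_ ∷ xs!) = xs!

Unique-map : {f : A → B} {xs : List A} →
             (∀ {x y} → x ∈ xs → y ∈ xs → f x ≡ f y → x ≡ y) →
             Unique xs → Unique (map f xs)
Unique-map inj []          = []
Unique-map inj (x≢ ∷ xs!) =
  Allₚ.map⁺ (All.tabulate λ y∈xs fx≡fy →
    All.lookup x≢ y∈xs (inj (here refl) (there y∈xs) fx≡fy)) ∷
  Unique-map (λ p q → inj (there p) (there q)) xs!

∈-tail : {x y : A} {xs : List A} → y ∈ x ∷ xs → y ≢ x → y ∈ xs
∈-tail (here y≡x)   y≢x = contradiction y≡x y≢x
∈-tail (there y∈xs) _   = y∈xs

-- Each head of `xs` is struck out of `ys`, and the length bound leaves nothing over. This turns
-- inclusions between node sets of equal size into equalities.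
⊆∧length⇒↭ : {xs ys : List A} → Unique xs → xs ⊆ ys → length ys ≤ℕ length xs → xs ↭ ys
⊆∧length⇒↭ {xs = []} {[]} _ _ _ = Perm.refl
⊆∧length⇒↭ {xs = x ∷ xs} {ys} (x≢ ∷ xs!) xs⊆ys ∣ys∣≤∣xs∣
  with zs , ys↭ ← ∈⇒↭∷ (xs⊆ys (here refl)) =
  Perm.trans (Perm.prep x (⊆∧length⇒↭ xs! xs⊆zs (ℕₚ.≤-pred
    (subst (_≤ℕ _) (↭-length ys↭) ∣ys∣≤∣xs∣)))) (↭-sym ys↭)
  where
  xs⊆zs : xs ⊆ zs
  xs⊆zs y∈xs = ∈-tail (∈-resp-↭ ys↭ (xs⊆ys (there y∈xs)))
    λ y≡x → All.lookup x≢ y∈xs (sym y≡x)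

length-⊆ : {xs ys : List A} → Unique xs → xs ⊆ ys → length xs ≤ℕ length ys
length-⊆ {xs = xs} {ys} xs! xs⊆ys with ℕₚ.≤-total (length xs) (length ys)
... | inj₁ ∣xs∣≤∣ys∣ = ∣xs∣≤∣ys∣
... | inj₂ ∣ys∣≤∣xs∣ = ℕₚ.≤-reflexive (↭-length (⊆∧length⇒↭ xs! xs⊆ys ∣ys∣≤∣xs∣))

module _ (_≟_ : DecidableEquality A) where
  open DecMembership _≟_ using (_∈?_)

  ⊆⊎∃∉ : (xs ys : List A) → xs ⊆ ys ⊎ ∃[ x ] (x ∈ xs × x ∉ ys)
  ⊆⊎∃∉ xs ys with All.all? (_∈? ys) xs
  ... | yes all = inj₁ (All.lookup all)
  ... | no ¬all = inj₂ (find (Allₚ.¬All⇒Any¬ (_∈? ys) xs ¬all))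

longest : (x : List A) (xs : List (List A)) →
          ∃[ y ] (y ∈ x ∷ xs × ∀ {z} → z ∈ x ∷ xs → length z ≤ℕ length y)
longest x [] = x , here refl , λ { (here refl) → ℕₚ.≤-refl }
longest x (x′ ∷ xs) with longest x′ xs
... | y , y∈ , max with ℕₚ.≤-total (length x) (length y)
...   | inj₁ x≤y = y , there y∈ , λ { (here refl) → x≤y ; (there z∈) → max z∈ }
...   | inj₂ y≤x = x , here refl ,
          λ { (here refl) → ℕₚ.≤-refl ; (there z∈) → ℕₚ.≤-trans (max z∈) y≤x }

∷++-≢ : ∀ (x : A) xs ys → x ∷ xs ++ ys ≢ ys
∷++-≢ x xs ys eq with () ← ++-identityˡ-unique (x ∷ xs) (sym eq)

≢[]⇒∷ : (xs : List A) → xs ≢ [] → ∃[ y ] ∃[ ys ] xs ≡ y ∷ ys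
≢[]⇒∷ []       []≢[] = contradiction refl []≢[]
≢[]⇒∷ (y ∷ ys) _     = y , ys , refl

-- Trees as pairs of node lists.

_≟ᴺ_ : ∀ {r} → DecidableEquality (Node r)
_≟ᴺ_ = ≡-dec Fin._≟_

module _ {r : ℕ} where
  open DecMembership (_≟ᴺ_ {r}) public using (_∈?_; _∉?_)

-- Requiring parents to be non-terminals makes the terminals leaves.
record IsTree {r : ℕ} (N D : List (Node r)) : Set where
  field
    N-unique : Unique N
    D-unique : Unique D
    disjoint : Disjoint N D
    root-∈   : [] ∈ N ⊎ [] ∈ D
    parent-∈ : ∀ {i u} → (i ∷ u) ∈ N ⊎ (i ∷ u) ∈ D → u ∈ N

  root-∈N : ∀ {u} → u ∈ N → [] ∈ N
  root-∈N {[]}    u∈N = u∈N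
  root-∈N {i ∷ u} u∈N = root-∈N (parent-∈ (inj₁ u∈N))

open IsTree

module _ {r : ℕ} where

  fromTree : ∀ {n} (T : Tree r n) → IsTree (Tree.nonTerminals T) (Tree.terminals T)
  fromTree T = record
    { N-unique = nonTerminals-unique
    ; D-unique = terminals-unique
    ; disjoint = Tree.disjoint T
    ; root-∈   = Tree.root-∈ T
    ; parent-∈ = λ iu∈T → [ id , (λ u∈D → contradiction iu∈T (terminals-leaf u∈D)) ]′ (Tree.parent-∈ T iu∈T)
    }
    where open Tree T using (nonTerminals-unique; terminals-unique; terminals-leaf)

  toTree : ∀ {n} {N D : List (Node r)} → IsTree N D → length D ≡ n → Tree r n
  toTree {N = N} {D} t ∣D∣≡n = record
    { nonTerminals        = N
    ; terminals           = D
    ; nonTerminals-unique = N-unique t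
    ; terminals-unique    = D-unique t
    ; disjoint            = disjoint t
    ; root-∈              = root-∈ t
    ; parent-∈            = inj₁ ∘ parent-∈ t
    ; terminals-leaf      = λ u∈D iu∈T → disjoint t (parent-∈ t iu∈T , u∈D)
    ; n-terminals         = ∣D∣≡n
    }

  IsTree-resp-↭ : {N N′ D D′ : List (Node r)} → N ↭ N′ → D ↭ D′ → IsTree N D → IsTree N′ D′
  IsTree-resp-↭ N↭ D↭ t = record
    { N-unique = Unique-resp-↭ N↭ (N-unique t)
    ; D-unique = Unique-resp-↭ D↭ (D-unique t)
    ; disjoint = λ (x∈N , x∈D) → disjoint t (∈-resp-↭ (↭-sym N↭) x∈N , ∈-resp-↭ (↭-sym D↭) x∈D)
    ; root-∈   = ⊎-map (∈-resp-↭ N↭) (∈-resp-↭ D↭) (root-∈ t)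
    ; parent-∈ = ∈-resp-↭ N↭ ∘ parent-∈ t ∘ ⊎-map (∈-resp-↭ (↭-sym N↭)) (∈-resp-↭ (↭-sym D↭))
    }

  deleteTerminal : {N D : List (Node r)} {w : Node r} → [] ∈ N → IsTree N (w ∷ D) → IsTree N D
  deleteTerminal []∈N t = record
    { N-unique = N-unique t
    ; D-unique = Unique-tail (D-unique t)
    ; disjoint = λ (x∈N , x∈D) → disjoint t (x∈N , there x∈D)
    ; root-∈   = inj₁ []∈N
    ; parent-∈ = parent-∈ t ∘ ⊎-map id there
    }

  insertTerminal : {N D : List (Node r)} {i : Fin r} {v : Node r} →
                   v ∈ N → (i ∷ v) ∉ N → (i ∷ v) ∉ D → IsTree N D → IsTree N ((i ∷ v) ∷ D)
  insertTerminal v∈N iv∉N iv∉D t = record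
    { N-unique = N-unique t
    ; D-unique = Unique-∷ iv∉D (D-unique t)
    ; disjoint = λ { (x∈N , here refl) → iv∉N x∈N ; (x∈N , there x∈D) → disjoint t (x∈N , x∈D) }
    ; root-∈   = ⊎-map id there (root-∈ t)
    ; parent-∈ = λ { (inj₁ x∈N)         → parent-∈ t (inj₁ x∈N)
                   ; (inj₂ (here refl)) → v∈N
                   ; (inj₂ (there x∈D)) → parent-∈ t (inj₂ x∈D) }
    }

-- Splicing out a non-terminal with at most one child

module _ {r : ℕ} (u : Node r) (i : Fin r) where

  -- Lifts the subtree at the child `i ∷ u` onto `u`. Paths list the last edge first, so lying below
  -- that child means having the suffix `i ∷ u`.
  contract : Node r → Node r
  contract []      = []
  contract (j ∷ v) with (j ∷ v) ≟ᴺ (i ∷ u)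
  ... | yes _ = u
  ... | no  _ = j ∷ contract v

  contract-child : contract (i ∷ u) ≡ u
  contract-child with (i ∷ u) ≟ᴺ (i ∷ u)
  ... | yes _ = refl
  ... | no ¬p = contradiction refl ¬p

  contract-view : ∀ v → (∃[ s ] (v ≡ s ++ i ∷ u × contract v ≡ s ++ u)) ⊎
                        ((∀ s → v ≢ s ++ i ∷ u) × contract v ≡ v)
  contract-view [] = inj₂ ((λ { [] () ; (_ ∷ _) () }) , refl)
  contract-view (j ∷ v) with (j ∷ v) ≟ᴺ (i ∷ u)
  ... | yes eq = inj₁ ([] , eq , refl)
  ... | no neq with contract-view v
  ...   | inj₁ (s , eq , eq′) = inj₁ (j ∷ s , cong (j ∷_) eq , cong (j ∷_) eq′)
  ...   | inj₂ (v≢ , eq)      = inj₂ ((λ { [] → neq ; (_ ∷ s) → v≢ s ∘ ∷-injectiveʳ }) , cong (j ∷_) eq)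

  contract-short : ∀ v → length v ≤ℕ length u → contract v ≡ v
  contract-short []      _ = refl
  contract-short (j ∷ v) ∣jv∣≤∣u∣ with (j ∷ v) ≟ᴺ (i ∷ u)
  ... | yes refl = contradiction ∣jv∣≤∣u∣ ℕₚ.1+n≰n
  ... | no  _    = cong (j ∷_) (contract-short v (ℕₚ.<⇒≤ ∣jv∣≤∣u∣))

  module _ {N D : List (Node r)} (t : IsTree (u ∷ N) D)
           (only : ∀ {j} → (j ∷ u) ∈ u ∷ N ⊎ (j ∷ u) ∈ D → j ≡ i) where

    private
      InT : Node r → Set
      InT v = v ∈ N ⊎ v ∈ D

      ≢u : ∀ {v} → InT v → v ≢ u
      ≢u (inj₁ v∈N) refl = Unique-head (N-unique t) v∈N
      ≢u (inj₂ v∈D) refl = disjoint t (here refl , v∈D)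

      -- Climbing from `v` towards `u` stays inside the tree, and by `only` the last node met before
      -- `u` is `i ∷ u`.
      through-child : ∀ s {v} → InT v → v ≡ s ++ u → InT (i ∷ u) × ∃[ s′ ] v ≡ s′ ++ i ∷ u
      through-child []          v∈T eq   = contradiction eq (≢u v∈T)
      through-child (k ∷ [])    v∈T refl with refl ← only (⊎-map there id v∈T) = v∈T , [] , refl
      through-child (k ∷ l ∷ s) v∈T refl
        with iu∈T , s′ , eq ← through-child (l ∷ s) (inj₁ (∈-tail (parent-∈ t (⊎-map there id v∈T)) (∷++-≢ l s u))) refl
        = iu∈T , k ∷ s′ , cong (k ∷_) eq

      -- Two lifted nodes are compared by cancelling the suffix `u`. A fixed node cannot meet a
      -- lifted one: it would lie below `u`, hence below `i ∷ u`, and would not be fixed.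
      contract-injective : ∀ {v w} → InT v → InT w → contract v ≡ contract w → v ≡ w
      contract-injective {v} {w} v∈T w∈T eq with contract-view v | contract-view w
      ... | inj₁ (s , v≡ , cv) | inj₁ (s′ , w≡ , cw) =
        trans v≡ (trans (cong (_++ i ∷ u) (++-cancelʳ u s s′ (trans (sym cv) (trans eq cw)))) (sym w≡))
      ... | inj₁ (s , v≡ , cv) | inj₂ (w≢ , cw)
        with _ , s′ , w≡ ← through-child s w∈T (trans (sym cw) (trans (sym eq) cv)) = contradiction w≡ (w≢ s′)
      ... | inj₂ (v≢ , cv) | inj₁ (s , w≡ , cw)
        with _ , s′ , v≡ ← through-child s v∈T (trans (sym cv) (trans eq cw)) = contradiction v≡ (v≢ s′)
      ... | inj₂ (_ , cv) | inj₂ (_ , cw) = trans (sym cv) (trans eq cw)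

      -- The child `i ∷ u` lands on `u` and inherits the parent of `u`, which is too short to be
      -- moved. At every other node `contract` commutes with taking parents.
      contract-parent : ∀ v {j p} → InT v → contract v ≡ j ∷ p → p ∈ map contract N
      contract-parent (k ∷ v) v∈T eq with (k ∷ v) ≟ᴺ (i ∷ u)
      contract-parent (k ∷ v) {j} {p} v∈T refl | yes refl =
        subst (_∈ map contract N) (contract-short p (ℕₚ.n≤1+n _))
          (∈-map⁺ contract (∈-tail (parent-∈ t (inj₁ (here refl))) (∷++-≢ j [] p ∘ sym)))
      contract-parent (k ∷ v) v∈T refl | no kv≢iu =
        ∈-map⁺ contract (∈-tail (parent-∈ t (⊎-map there id v∈T))
          λ { refl → kv≢iu (cong (_∷ u) (only (⊎-map there id v∈T))) })

      InT-map : ∀ {v} → InT v → contract v ∈ map contract N ⊎ contract v ∈ map contract D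
      InT-map = ⊎-map (∈-map⁺ contract) (∈-map⁺ contract)

      contract-root : ∀ {x} → x ∈ D → [] ∈ map contract N ⊎ [] ∈ map contract D
      contract-root x∈D with [] ≟ᴺ u
      ... | yes refl with iu∈T , _ ← through-child _ (inj₂ x∈D) (sym (++-identityʳ _)) =
        subst (λ y → y ∈ map contract N ⊎ y ∈ map contract D) contract-child (InT-map iu∈T)
      ... | no []≢u = InT-map (⊎-map (λ p → ∈-tail p []≢u) id (root-∈ t))

    -- `only` also allows `u` to be childless; then `u` is merely dropped. The terminal `x` matters
    -- when `u` is the root: it forces a child of the root to exist, which becomes the new root.
    contract-isTree : ∀ {x} → x ∈ D → IsTree (map contract N) (map contract D)
    contract-isTree x∈D = record
      { N-unique = Unique-map (λ p q → contract-injective (inj₁ p) (inj₁ q)) (Unique-tail (N-unique t))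
      ; D-unique = Unique-map (λ p q → contract-injective (inj₂ p) (inj₂ q)) (D-unique t)
      ; disjoint = dis
      ; root-∈   = contract-root x∈D
      ; parent-∈ = par
      }
      where
      dis : Disjoint (map contract N) (map contract D)
      dis (x∈N , x∈D) with ∈-map⁻ contract x∈N | ∈-map⁻ contract x∈D
      ... | v , v∈N , eq | v′ , v′∈D , eq′
        with refl ← contract-injective (inj₁ v∈N) (inj₂ v′∈D) (trans (sym eq) eq′) =
        disjoint t (there v∈N , v′∈D)

      par : ∀ {j p} → (j ∷ p) ∈ map contract N ⊎ (j ∷ p) ∈ map contract D → p ∈ map contract N
      par (inj₁ jp∈) with v , v∈ , eq ← ∈-map⁻ contract jp∈ = contract-parent v (inj₁ v∈) (sym eq)
      par (inj₂ jp∈) with v , v∈ , eq ← ∈-map⁻ contract jp∈ = contract-parent v (inj₂ v∈) (sym eq)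

-- Moving the children of a lowest non-terminal to a new non-terminal

module _ {r : ℕ} (u w : Node r) where

  -- Moves the children of `u` but not their descendants, which suffices because it is applied only
  -- where these children are leaves.
  graft : Node r → Node r
  graft []      = []
  graft (j ∷ v) with v ≟ᴺ u
  ... | yes _ = j ∷ w
  ... | no  _ = j ∷ v

  graft-view : ∀ x → (∃[ k ] (x ≡ k ∷ u × graft x ≡ k ∷ w)) ⊎ ((∀ {k} → x ≢ k ∷ u) × graft x ≡ x)
  graft-view []      = inj₂ ((λ ()) , refl)
  graft-view (j ∷ v) with v ≟ᴺ u
  ... | yes refl = inj₁ (j , refl , refl)
  ... | no v≢u   = inj₂ (v≢u ∘ ∷-injectiveʳ , refl)

  module _ {N D : List (Node r)} (t : IsTree (u ∷ N) D) (w∉uN : w ∉ u ∷ N) where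

    private
      -- The places below `w` are vacant because `w` is not a non-terminal; hence moved children
      -- collide with nothing.
      wk∉T : ∀ {k} → ¬ ((k ∷ w) ∈ u ∷ N ⊎ (k ∷ w) ∈ D)
      wk∉T = w∉uN ∘ parent-∈ t

    graft-≢u : ∀ {x} → x ∈ D → graft x ≢ u
    graft-≢u {x} x∈D eq with graft-view x
    ... | inj₁ (k , _ , gx) = wk∉T (inj₁ (here (trans (sym gx) eq)))
    ... | inj₂ (_ , gx) with refl ← trans (sym gx) eq = disjoint t (here refl , x∈D)

    -- The parent of `w` is required in `N`, not just in `u ∷ N`, so that it survives when `u` stops
    -- being a non-terminal. A terminal at `w` has to be deleted beforehand.
    graft-isTree : ∀ {i p} → w ≡ i ∷ p → p ∈ N → w ∉ D → [] ∈ N → (∀ {k} → (k ∷ u) ∉ N) →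
                   IsTree (w ∷ N) (map graft D)
    graft-isTree w≡ip p∈N w∉D []∈N leaf = record
      { N-unique = Unique-∷ (w∉uN ∘ there) (Unique-tail (N-unique t))
      ; D-unique = Unique-map inj (D-unique t)
      ; disjoint = dis
      ; root-∈   = inj₁ (there []∈N)
      ; parent-∈ = par
      }
      where
      inj : ∀ {x y} → x ∈ D → y ∈ D → graft x ≡ graft y → x ≡ y
      inj {x} {y} x∈D y∈D eq with graft-view x | graft-view y
      ... | inj₁ (k , refl , gx) | inj₁ (l , refl , gy) =
        cong (_∷ u) (∷-injectiveˡ (trans (sym gx) (trans eq gy)))
      ... | inj₁ (k , _ , gx) | inj₂ (_ , gy) =
        contradiction (inj₂ (subst (_∈ D) (trans (sym gy) (trans (sym eq) gx)) y∈D)) wk∉T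
      ... | inj₂ (_ , gx) | inj₁ (l , _ , gy) =
        contradiction (inj₂ (subst (_∈ D) (trans (sym gx) (trans eq gy)) x∈D)) wk∉T
      ... | inj₂ (_ , gx) | inj₂ (_ , gy) = trans (sym gx) (trans eq gy)

      graft-∉ : ∀ x → x ∈ D → graft x ∉ w ∷ N
      graft-∉ x x∈D gx∈ with graft-view x
      graft-∉ x x∈D (here gx≡w)  | inj₁ (k , _ , gx) = ∷++-≢ k [] w (trans (sym gx) gx≡w)
      graft-∉ x x∈D (there gx∈N) | inj₁ (k , _ , gx) = wk∉T (inj₁ (there (subst (_∈ N) gx gx∈N)))
      graft-∉ x x∈D (here gx≡w)  | inj₂ (_ , gx) = w∉D (subst (_∈ D) (trans (sym gx) gx≡w) x∈D)
      graft-∉ x x∈D (there gx∈N) | inj₂ (_ , gx) = disjoint t (there (subst (_∈ N) gx gx∈N) , x∈D)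

      dis : Disjoint (w ∷ N) (map graft D)
      dis (y∈N , y∈D) with x , x∈D , refl ← ∈-map⁻ graft y∈D = graft-∉ x x∈D y∈N

      par : ∀ {j v} → (j ∷ v) ∈ w ∷ N ⊎ (j ∷ v) ∈ map graft D → v ∈ w ∷ N
      par (inj₁ (here jv≡w)) with refl ← trans jv≡w w≡ip = there p∈N
      par (inj₁ (there jv∈N)) = there (∈-tail (parent-∈ t (inj₁ (there jv∈N))) λ { refl → leaf jv∈N })
      par (inj₂ jv∈) with ∈-map⁻ graft jv∈
      ... | x , x∈D , eq with graft-view x
      ...   | inj₁ (k , _ , gx) = here (∷-injectiveʳ (trans eq gx))
      ...   | inj₂ (x≢ , gx) with refl ← trans eq gx =
        there (∈-tail (parent-∈ t (inj₂ x∈D)) λ { refl → x≢ refl })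

-- Sums over lists in an ordered abelian group.

module _ {a ℓ₁ ℓ₂} (G : OrderedAbelianGroup a ℓ₁ ℓ₂) where
  open OrderedAbelianGroup G
  open IsAbelianGroup isAbelianGroup using (isCommutativeMonoid)

  private
    commutativeMonoid : CommutativeMonoid a ℓ₁
    commutativeMonoid = record { isCommutativeMonoid = isCommutativeMonoid }

    poset : Poset a ℓ₁ ℓ₂
    poset = record { isPartialOrder = isPartialOrder }

    open CommutativeMonoid commutativeMonoid using (commutativeSemigroup; ∙-congˡ; identityˡ)
    open Poset poset using () renaming (refl to ≤-refl; trans to ≤-trans; reflexive to ≤-reflexive)
    open import Algebra.Properties.CommutativeSemigroup commutativeSemigroup using (x∙yz≈y∙xz; xy∙z≈y∙xz)
    open import Relation.Binary.Reasoning.PartialOrder poset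

  module _ (f : A → Carrier) where

    Σ : List A → Carrier
    Σ xs = foldr _+_ 0# (map f xs)

    Σ-↭ : {xs ys : List A} → xs ↭ ys → Σ xs ≤ Σ ys
    Σ-↭ Perm.refl          = ≤-refl
    Σ-↭ (Perm.prep x p)    = +-mono-≤ ≤-refl (Σ-↭ p)
    Σ-↭ (Perm.swap x y p)  = ≤-trans (≤-reflexive (x∙yz≈y∙xz _ _ _)) (+-mono-≤ ≤-refl (+-mono-≤ ≤-refl (Σ-↭ p)))
    Σ-↭ (Perm.trans p q)   = ≤-trans (Σ-↭ p) (Σ-↭ q)

    Σ-map-≤ : {g : A → A} → (∀ x → f (g x) ≤ f x) → ∀ xs → Σ (map g xs) ≤ Σ xs
    Σ-map-≤ fg≤f []       = ≤-refl
    Σ-map-≤ fg≤f (x ∷ xs) = +-mono-≤ (fg≤f x) (Σ-map-≤ fg≤f xs)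

    -- Common entries cancel, and the others are paired arbitrarily; equal lengths guarantee a
    -- partner for each. No comparison of values is decided, so a partial order is enough.
    Σ-exchange : DecidableEquality A → {xs ys : List A} →
                 Unique xs → Unique ys → length xs ≡ length ys →
                 (∀ {x y} → x ∈ xs → x ∉ ys → y ∈ ys → y ∉ xs → f x ≤ f y) → Σ xs ≤ Σ ys
    Σ-exchange _≟_ {[]} {[]} _ _ _ _ = ≤-refl
    Σ-exchange _≟_ {x ∷ xs} {ys} (x≢ ∷ xs!) ys! len f≤ with DecMembership._∈?_ _≟_ x ys
    ... | yes x∈ys with zs , ys↭ ← ∈⇒↭∷ x∈ys = begin
      f x + Σ xs ≤⟨ +-mono-≤ ≤-refl (Σ-exchange _≟_ xs! (Unique-tail xzs!)
                      (ℕₚ.suc-injective (trans len (↭-length ys↭))) f≤′) ⟩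
      Σ (x ∷ zs) ≤⟨ Σ-↭ (↭-sym ys↭) ⟩
      Σ ys       ∎
      where
      xzs! = Unique-resp-↭ ys↭ ys!
      f≤′ : ∀ {x′ y} → x′ ∈ xs → x′ ∉ zs → y ∈ zs → y ∉ xs → f x′ ≤ f y
      f≤′ x′∈ x′∉ y∈ y∉ = f≤ (there x′∈)
        (λ x′∈ys → x′∉ (∈-tail (∈-resp-↭ ys↭ x′∈ys) λ x′≡x → All.lookup x≢ x′∈ (sym x′≡x)))
        (∈-resp-↭ (↭-sym ys↭) (there y∈))
        (λ y∈xxs → y∉ (∈-tail y∈xxs λ { refl → Unique-head xzs! y∈ }))
    ... | no x∉ys with ⊆⊎∃∉ _≟_ ys xs
    ...   | inj₁ ys⊆xs = contradiction
              (subst (_≤ℕ _) (sym len) (length-⊆ ys! ys⊆xs)) ℕₚ.1+n≰n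
    ...   | inj₂ (y , y∈ys , y∉xs) with zs , ys↭ ← ∈⇒↭∷ y∈ys = begin
      f x + Σ xs ≤⟨ +-mono-≤ (f≤ (here refl) x∉ys y∈ys λ y∈ → y∉xs (∈-tail y∈ λ { refl → x∉ys y∈ys }))
                      (Σ-exchange _≟_ xs! (Unique-tail (Unique-resp-↭ ys↭ ys!))
                        (ℕₚ.suc-injective (trans len (↭-length ys↭))) f≤′) ⟩
      Σ (y ∷ zs) ≤⟨ Σ-↭ (↭-sym ys↭) ⟩
      Σ ys       ∎
      where
      f≤′ : ∀ {x′ y′} → x′ ∈ xs → x′ ∉ zs → y′ ∈ zs → y′ ∉ xs → f x′ ≤ f y′
      f≤′ x′∈ x′∉ y′∈ y′∉ = f≤ (there x′∈)
        (λ x′∈ys → x′∉ (∈-tail (∈-resp-↭ ys↭ x′∈ys) λ { refl → y∉xs x′∈ }))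
        y′∈ys
        (λ y′∈xxs → y′∉ (∈-tail y′∈xxs λ { refl → x∉ys y′∈ys }))
        where y′∈ys = ∈-resp-↭ (↭-sym ys↭) (there y′∈)

  -- Depths and costs under contraction and grafting.

  module _ {r : ℕ} (c : Fin r → Carrier) (c≥0 : ∀ i → 0# ≤ c i) where
    open Lengths G c

    private
      Σd : List (Node r) → Carrier
      Σd = Σ depth

    depth-∷ : ∀ i u → depth u ≤ depth (i ∷ u)
    depth-∷ i u = begin
      depth u       ≈⟨ identityˡ _ ⟨
      0# + depth u  ≤⟨ +-mono-≤ (c≥0 i) ≤-refl ⟩
      c i + depth u ∎

    depth-contract : ∀ u i v → depth (contract u i v) ≤ depth v
    depth-contract u i []      = ≤-refl
    depth-contract u i (j ∷ v) with (j ∷ v) ≟ᴺ (i ∷ u)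
    ... | yes refl = depth-∷ j v
    ... | no  _    = +-mono-≤ ≤-refl (depth-contract u i v)

    module _ {u w : Node r} (w≤u : depth w ≤ depth u) where

      depth-graft : ∀ x → depth (graft u w x) ≤ depth x
      depth-graft []      = ≤-refl
      depth-graft (j ∷ v) with v ≟ᴺ u
      ... | yes refl = +-mono-≤ ≤-refl w≤u
      ... | no  _    = ≤-refl

      -- The saving on one grafted child pays for replacing the terminal w by u.
      Σ-graft : ∀ {k D} → (k ∷ u) ∈ D → depth u + Σd (map (graft u w) D) ≤ depth w + Σd D
      Σ-graft {k} {x ∷ D} (here refl) with u ≟ᴺ u
      ... | no u≢u = contradiction refl u≢u
      ... | yes _  = begin
        depth u + ((c k + depth w) + Σd (map (graft u w) D)) ≤⟨ +-mono-≤ ≤-refl (+-mono-≤ ≤-refl (Σ-map-≤ depth depth-graft D)) ⟩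
        depth u + ((c k + depth w) + Σd D)                   ≈⟨ ∙-congˡ (xy∙z≈y∙xz _ _ _) ⟩
        depth u + (depth w + (c k + Σd D))                   ≈⟨ x∙yz≈y∙xz _ _ _ ⟩
        depth w + (depth u + (c k + Σd D))                   ≈⟨ ∙-congˡ (xy∙z≈y∙xz _ _ _) ⟨
        depth w + ((c k + depth u) + Σd D)                   ∎
      Σ-graft {k} {x ∷ D} (there ku∈D) = begin
        depth u + (depth (graft u w x) + Σd (map (graft u w) D)) ≈⟨ x∙yz≈y∙xz _ _ _ ⟩
        depth (graft u w x) + (depth u + Σd (map (graft u w) D)) ≤⟨ +-mono-≤ (depth-graft x) (Σ-graft ku∈D) ⟩
        depth x + (depth w + Σd D)                               ≈⟨ x∙yz≈y∙xz _ _ _ ⟩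
        depth w + (depth x + Σd D)                               ∎

    -- Optimal trees with the fewest non-terminals.

    module _ {n m : ℕ} (1≤n : 1 ≤ℕ n) (min : IsMinNonTerminals n m) where
      open IsMinNonTerminals min

      -- Least cost and, among optimal trees, fewest non-terminals. Indexing by the two lists lets
      -- them be permuted and exchanged directly.
      record MinimalTree (N D : List (Node r)) : Set ℓ₂ where
        field
          isTree  : IsTree N D
          ∣N∣≡m   : length N ≡ m
          ∣D∣≡n   : length D ≡ n
          optimal : ∀ (T : Tree r n) → Σd D ≤ cost T

      open MinimalTree

      MinimalTree-resp-↭ : ∀ {N N′ D D′} → N ↭ N′ → D ↭ D′ → MinimalTree N D → MinimalTree N′ D′
      MinimalTree-resp-↭ N↭ D↭ M = record
        { isTree  = IsTree-resp-↭ N↭ D↭ (isTree M)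
        ; ∣N∣≡m   = trans (sym (↭-length N↭)) (∣N∣≡m M)
        ; ∣D∣≡n   = trans (sym (↭-length D↭)) (∣D∣≡n M)
        ; optimal = λ T → ≤-trans (Σ-↭ depth (↭-sym D↭)) (optimal M T)
        }

      -- Contracting at `u` would give an optimal tree with one non-terminal fewer than `m`. The
      -- bound `1 ≤ n` supplies the terminal that contraction needs.
      not-only-child : ∀ {N D u} i → MinimalTree (u ∷ N) D →
                       ¬ (∀ {j} → (j ∷ u) ∈ u ∷ N ⊎ (j ∷ u) ∈ D → j ≡ i)
      not-only-child {D = []} _ M _ = contradiction (subst (1 ≤ℕ_) (sym (∣D∣≡n M)) 1≤n) λ ()
      not-only-child {N} {D@(_ ∷ _)} {u} i M only = ℕₚ.1+n≰n
        (subst₂ _≤ℕ_ (sym (∣N∣≡m M)) (length-map f N)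
          (minimal T′ λ T → ≤-trans (Σ-map-≤ depth (depth-contract u i) D) (optimal M T)))
        where
        f = contract u i
        T′ : Tree r n
        T′ = toTree (contract-isTree u i (isTree M) only (here refl)) (trans (length-map f D) (∣D∣≡n M))

      proper : ∀ {N D u} → Fin r → MinimalTree N D → u ∈ N →
               ∃[ i ] ∃[ j ] (i ≢ j × ((i ∷ u) ∈ N ⊎ (i ∷ u) ∈ D) × ((j ∷ u) ∈ N ⊎ (j ∷ u) ∈ D))
      proper {N} {D} {u} i₀ M u∈N with N₀ , N↭ ← ∈⇒↭∷ u∈N = go
        where
        InT? : ∀ i → Dec ((i ∷ u) ∈ N ⊎ (i ∷ u) ∈ D)
        InT? i = ((i ∷ u) ∈? N) ⊎-dec ((i ∷ u) ∈? D)

        not-only : ∀ i → ¬ (∀ {j} → (j ∷ u) ∈ N ⊎ (j ∷ u) ∈ D → j ≡ i)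
        not-only i only = not-only-child i (MinimalTree-resp-↭ N↭ Perm.refl M)
          (only ∘ ⊎-map (∈-resp-↭ (↭-sym N↭)) id)

        go : ∃[ i ] ∃[ j ] (i ≢ j × ((i ∷ u) ∈ N ⊎ (i ∷ u) ∈ D) × ((j ∷ u) ∈ N ⊎ (j ∷ u) ∈ D))
        go with Finₚ.any? InT?
        -- A childless `u` satisfies the only-child condition vacuously, for any label; `i₀` is just
        -- some label.
        ... | no none = contradiction (λ {j} j∈T → contradiction (j , j∈T) none) (not-only i₀)
        ... | yes (i , i∈T) with Finₚ.any? (λ j → ¬? (i Fin.≟ j) ×-dec InT? j)
        ...   | yes (j , i≢j , j∈T) = i , j , i≢j , i∈T , j∈T
        ...   | no none = contradiction
                (λ {j} j∈T → decidable-stable (j Fin.≟ i) λ j≢i → none (j , j≢i ∘ sym , j∈T)) (not-only i)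

      module _ {N D : List (Node r)} {u w p : Node r} {i k : Fin r}
               (M : MinimalTree (u ∷ N) D) (w≤u : depth w ≤ depth u)
               (leaf : ∀ {k} → (k ∷ u) ∉ N) (ku∈D : (k ∷ u) ∈ D)
               (w≡ip : w ≡ i ∷ p) (p∈N : p ∈ N) (w∉uN : w ∉ u ∷ N) ([]∈N : [] ∈ N) where

        -- If `w` is a terminal, it is deleted and `u` becomes a terminal in its stead, which keeps
        -- their number at `n`; `Σ-graft` absorbs the extra depth.
        graft-minimal : ∃[ D′ ] (MinimalTree (w ∷ N) D′ × Σd D′ ≤ Σd D)
        graft-minimal with w ∈? D
        ... | no w∉D = map g D , record
          { isTree  = graft-isTree u w (isTree M) w∉uN w≡ip p∈N w∉D []∈N leaf
          ; ∣N∣≡m   = ∣N∣≡m M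
          ; ∣D∣≡n   = trans (length-map g D) (∣D∣≡n M)
          ; optimal = λ T → ≤-trans Σ≤ (optimal M T)
          } , Σ≤
          where
          g = graft u w
          Σ≤ : Σd (map g D) ≤ Σd D
          Σ≤ = Σ-map-≤ depth (depth-graft w≤u) D
        ... | yes w∈D with D₀ , D↭ ← ∈⇒↭∷ w∈D = u ∷ map g D₀ , record
          { isTree  = tree u≡jv
          ; ∣N∣≡m   = ∣N∣≡m M
          ; ∣D∣≡n   = trans (cong suc (length-map g D₀)) (trans (sym (↭-length D↭)) (∣D∣≡n M))
          ; optimal = λ T → ≤-trans Σ≤ (optimal M T)
          } , Σ≤
          where
          g = graft u w

          t : IsTree (u ∷ N) (w ∷ D₀)
          t = IsTree-resp-↭ Perm.refl D↭ (isTree M)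

          t₀ : IsTree (u ∷ N) D₀
          t₀ = deleteTerminal (there []∈N) t

          u∉N : u ∉ N
          u∉N = Unique-head (N-unique t)

          u∉wN : u ∉ w ∷ N
          u∉wN (here u≡w)   = w∉uN (here (sym u≡w))
          u∉wN (there u∈N) = u∉N u∈N

          u∉gD₀ : u ∉ map g D₀
          u∉gD₀ u∈ with x , x∈D₀ , u≡gx ← ∈-map⁻ g u∈ = graft-≢u u w t₀ w∉uN x∈D₀ (sym u≡gx)

          -- The root lies in `N`, so `u` is not the root and has a parent below which it can be
          -- reinserted.
          u≡jv : ∃[ j ] ∃[ v ] u ≡ j ∷ v
          u≡jv = ≢[]⇒∷ u λ { refl → u∉N []∈N }

          tree : ∃[ j ] ∃[ v ] u ≡ j ∷ v → IsTree (w ∷ N) (u ∷ map g D₀)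
          tree (j , v , refl) = insertTerminal
            (there (∈-tail (parent-∈ t (inj₁ (here refl))) (∷++-≢ j [] v ∘ sym))) u∉wN u∉gD₀
            (graft-isTree u w t₀ w∉uN w≡ip p∈N (Unique-head (D-unique t)) []∈N leaf)

          -- The deleted terminal `w` is not the child `k ∷ u` itself: the parent of `w` is in `N`,
          -- and `u` is not.
          ku∈D₀ : (k ∷ u) ∈ D₀
          ku∈D₀ = ∈-tail (∈-resp-↭ D↭ ku∈D)
            λ ku≡w → u∉N (subst (_∈ N) (sym (∷-injectiveʳ (trans ku≡w w≡ip))) p∈N)

          Σ≤ : Σd (u ∷ map g D₀) ≤ Σd D
          Σ≤ = ≤-trans (Σ-graft w≤u ku∈D₀) (Σ-↭ depth (↭-sym D↭))

      -- Transforming a minimal tree into the shallow one.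

      module _ (T : Tree r n) (shallow : Shallow T) (∣S∣≡m : Tree.#nonTerminals T ≡ m) (i₀ : Fin r) where
        open Tree T using (nonTerminals; terminals)
        open Shallow shallow

        -- Climb from `w` until the parent is in `N`; the root stops the climb at the latest.
        topmost-missing : ∀ {N w} → [] ∈ N → w ∈ nonTerminals → w ∉ N →
                          ∃[ i ] ∃[ p ] ((i ∷ p) ∈ nonTerminals × (i ∷ p) ∉ N × p ∈ N)
        topmost-missing {w = []}    []∈N _ []∉N = contradiction []∈N []∉N
        topmost-missing {N} {i ∷ p} []∈N w∈S w∉N with p ∈? N
        ... | yes p∈N = i , p , w∈S , w∉N , p∈N
        ... | no  p∉N = topmost-missing []∈N (parent-∈ (fromTree T) (inj₁ w∈S)) p∉N

        -- A terminal of the minimal tree that is not one of `T` is a missing child of a shared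
        -- non-terminal, so `terminals-shallow` bounds the terminals of `T` by it.
        same-nonTerminals : ∀ {N D} → N ↭ nonTerminals → MinimalTree N D → cost T ≤ Σd D
        same-nonTerminals {N} {D} N↭ M = Σ-exchange depth _≟ᴺ_ (Tree.terminals-unique T)
          (D-unique (isTree M)) (trans (Tree.n-terminals T) (sym (∣D∣≡n M))) exchange
          where
          exchange : ∀ {x y} → x ∈ terminals → x ∉ D → y ∈ D → y ∉ terminals → depth x ≤ depth y
          exchange {y = []} _ _ y∈D y∉ with Tree.root-∈ T
          ... | inj₁ []∈S = contradiction (∈-resp-↭ (↭-sym N↭) []∈S , y∈D) (disjoint (isTree M))
          ... | inj₂ []∈D = contradiction []∈D y∉
          exchange {y = i ∷ v} x∈ _ y∈D y∉ = terminals-shallow x∈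
            (∈-resp-↭ N↭ (parent-∈ (isTree M) (inj₂ y∈D)))
            [ (λ y∈S → disjoint (isTree M) (∈-resp-↭ (↭-sym N↭) y∈S , y∈D)) , y∉ ]′

        -- Its length is the measure of the descent, falling by exactly one at each exchange.
        excess : List (Node r) → List (Node r)
        excess = filter (_∉? nonTerminals)

        -- Deepest by number of edges: letter lengths may be zero, so `depth` need not grow from
        -- parent to child. A child in `N` would be a longer excess node, since `nonTerminals` is
        -- closed under parents.
        deepest-excess : ∀ {N D} → IsTree N D → ∀ {u₀} → u₀ ∈ N → u₀ ∉ nonTerminals →
                         ∃[ u ] (u ∈ N × u ∉ nonTerminals × (∀ {k} → (k ∷ u) ∉ N))
        deepest-excess {N} t {u₀} u₀∈N u₀∉S
          with u , u∈ , max ← longest u₀ (excess N) = u , proj₁ (bounds u∈) , proj₂ (bounds u∈) , leaf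
          where
          bounds : ∀ {v} → v ∈ u₀ ∷ excess N → v ∈ N × v ∉ nonTerminals
          bounds (here refl) = u₀∈N , u₀∉S
          bounds (there v∈)  = ∈-filter⁻ (_∉? nonTerminals) v∈
          leaf : ∀ {k} → (k ∷ u) ∉ N
          leaf ku∈N = ℕₚ.1+n≰n (max (there (∈-filter⁺ (_∉? nonTerminals) ku∈N
            λ ku∈S → proj₂ (bounds u∈) (parent-∈ (fromTree T) (inj₁ ku∈S)))))

        common-∈ : ∀ {N N₀ u v} → u ∉ nonTerminals → N ↭ u ∷ N₀ → v ∈ nonTerminals → v ∈ N → v ∈ N₀
        common-∈ u∉S N↭ v∈S v∈N = ∈-tail (∈-resp-↭ N↭ v∈N) λ { refl → u∉S v∈S }

        -- Both sets have `m` elements, so an excess `u` forces a missing `w`. Properness gives `u`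
        -- a child, which `leaf` makes a terminal.
        reduce-excess : ∀ {N D u} → MinimalTree N D → u ∈ N → u ∉ nonTerminals → (∀ {k} → (k ∷ u) ∉ N) →
                        ∃[ N′ ] ∃[ D′ ] (MinimalTree N′ D′ × suc (length (excess N′)) ≡ length (excess N) × Σd D′ ≤ Σd D)
        reduce-excess {N} {D} {u} M u∈N u∉S leaf with ⊆⊎∃∉ _≟ᴺ_ nonTerminals N
        ... | inj₁ S⊆N = contradiction (∈-resp-↭ (↭-sym S↭N) u∈N) u∉S
          where
          S↭N : nonTerminals ↭ N
          S↭N = ⊆∧length⇒↭ (Tree.nonTerminals-unique T) S⊆N (ℕₚ.≤-reflexive (trans (∣N∣≡m M) (sym ∣S∣≡m)))
        ... | inj₂ (w₀ , w₀∈S , w₀∉N)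
          with i , p , w∈S , w∉N , p∈N ← topmost-missing (root-∈N (isTree M) u∈N) w₀∈S w₀∉N
             | k , _ , _ , ku∈T , _ ← proper i₀ M u∈N
             | N₀ , N↭ ← ∈⇒↭∷ u∈N
          with D′ , M′ , Σ≤ ← graft-minimal (MinimalTree-resp-↭ N↭ Perm.refl M)
                 -- Shallowness enters here: `w` is a non-terminal of `T` and `u` is not, so `w` is
                 -- no deeper.
                 (nonTerminals-shallow w∈S u∉S)
                 (leaf ∘ ∈-resp-↭ (↭-sym N↭) ∘ there)
                 ([ (λ ku∈N → contradiction ku∈N leaf) , id ]′ ku∈T)
                 refl
                 (common-∈ u∉S N↭ (parent-∈ (fromTree T) (inj₁ w∈S)) p∈N)
                 (w∉N ∘ ∈-resp-↭ (↭-sym N↭))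
                 (common-∈ u∉S N↭ (root-∈N (fromTree T) w∈S) (root-∈N (isTree M) u∈N))
          = (i ∷ p) ∷ N₀ , D′ , M′ , ∣excess∣ , Σ≤
          where
          ∣excess∣ : suc (length (excess ((i ∷ p) ∷ N₀))) ≡ length (excess N)
          ∣excess∣ = trans (cong (suc ∘ length) (filter-reject (_∉? nonTerminals) (λ w∉S → w∉S w∈S)))
            (trans (cong length (sym (filter-accept (_∉? nonTerminals) u∉S)))
              (sym (↭-length (filter-↭ (_∉? nonTerminals) N↭))))

        cost-≤ : ∀ k {N D} → length (excess N) ≤ℕ k → MinimalTree N D → cost T ≤ Σd D
        cost-≤ k {N} {D} ∣excess∣≤k M with ⊆⊎∃∉ _≟ᴺ_ N nonTerminals
        ... | inj₁ N⊆S = same-nonTerminals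
          (⊆∧length⇒↭ (N-unique (isTree M)) N⊆S (ℕₚ.≤-reflexive (trans ∣S∣≡m (sym (∣N∣≡m M))))) M
        ... | inj₂ (u₀ , u₀∈N , u₀∉S)
          with u , u∈N , u∉S , leaf ← deepest-excess (isTree M) u₀∈N u₀∉S
          with N′ , D′ , M′ , ∣excess∣ , Σ≤ ← reduce-excess M u∈N u∉S leaf
          -- The excess is a successor, so the bound `k` cannot be zero and the recursion on it is
          -- structural.
          with k | subst (_≤ℕ k) (sym ∣excess∣) ∣excess∣≤k
        ...   | suc k′ | s≤s ∣excess′∣≤k′ = ≤-trans (cost-≤ k′ ∣excess′∣≤k′ M′) Σ≤

lemma2p4 : ∀ {a ℓ₁ ℓ₂} (G : OrderedAbelianGroup a ℓ₁ ℓ₂) →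
    let open OrderedAbelianGroup G in
    (r n : ℕ) → 2 ≤ℕ r → 1 ≤ℕ n →
    (c : Fin r → Carrier) →
    (∀ i → 0# ≤ c i) → (∀ {i j} → i ≤ᶠ j → c i ≤ c j) →
    let open Lengths G c in
    (m* : ℕ) → IsMinNonTerminals n m* →
    (T : Tree r n) → Shallow T → Tree.#nonTerminals T ≡ m* →
    Optimal T × Proper T
lemma2p4 G r@(suc _) n 2≤r 1≤n c c≥0 _ m* min T shallow ∣S∣≡m* = T-optimal , T-proper
  where
  open OrderedAbelianGroup G
  open Lengths G c

  T-optimal : Optimal T
  T-optimal T′ with T* , T*-optimal , ∣T*∣≡m* ← IsMinNonTerminals.attained min =
    IsPartialOrder.trans isPartialOrder
      (cost-≤ G c c≥0 1≤n min T shallow ∣S∣≡m* Fin.zero _ ℕₚ.≤-refl record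
        { isTree  = fromTree T*
        ; ∣N∣≡m   = ∣T*∣≡m*
        ; ∣D∣≡n   = Tree.n-terminals T*
        ; optimal = T*-optimal
        })
      (T*-optimal T′)

  T-proper : Proper T
  -- Once known to be optimal, `T` is itself a minimal tree.
  T-proper = proper G c c≥0 1≤n min Fin.zero record
    { isTree  = fromTree T
    ; ∣N∣≡m   = ∣S∣≡m*
    ; ∣D∣≡n   = Tree.n-terminals T
    ; optimal = T-optimal
    }
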